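{- For every fixed integer $k>1$ the following holds. Let $H=(V,\mathcal{E})$ be a hypergraph with $n$ vertices and at most $m$ hyperedges. Then $\chi_{k\text{ -cf}}(H)=O\!\left(m^{\frac{1}{k+1}}\log^{\frac{k}{k+1}} n\right)$.
   Context: For a hypergraph $H=(V,\mathcal{E})$ and $k\in\mathbb{N}$, a $k$-CF-coloring is a map $c:V\to\mathbb{N}$ such that every (nonempty) hyperedge $S\in\mathcal{E}$ contains a color $i$ with $1\le|S\cap c^{ -1}(i)|\le k$. $\chi_{k\text{ -cf}}(H)$ is the minimum number of colors in a $k$-CF-coloring of $H$. -}

module Defs where

open import Data.Nat using (ℕ; _≤_)
open import Data.Fin using (Fin; _≟_)
open import Data.Fin.Subset using (Subset; _∩_; ∣_∣; Nonempty)
open import Data.Vec using (tabulate)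
open import Data.Product using (∃)
open import Relation.Nullary.Decidable using (⌊_⌋)

-- A hypergraph on vertex set Fin n with e hyperedges (indexed by Fin e;
-- repetitions allowed), each hyperedge a subset of the vertices.
Hypergraph : ℕ → ℕ → Set
Hypergraph n e = Fin e → Subset n

colorClass : ∀ {n t} → (Fin n → Fin t) → Fin t → Subset n
colorClass c i = tabulate (λ v → ⌊ c v ≟ i ⌋)

IsKCFColoring : ∀ {n e t} → ℕ → Hypergraph n e → (Fin n → Fin t) → Set
IsKCFColoring {e = e} {t = t} k H c =
  (j : Fin e) → Nonempty (H j) →
  ∃ λ (i : Fin t) → 1 ≤ ∣ H j ∩ colorClass c i ∣ × ∣ H j ∩ colorClass c i ∣ ≤ k
  where open import Data.Product using (_×_)

-- χ_{k-cf}(H) ≤ t  (there is a k-CF-colouring using at most t colours)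
KCFColorableWith : ∀ {n e} → ℕ → Hypergraph n e → ℕ → Set
KCFColorableWith k H t = ∃ λ (c : _ → Fin t) → IsKCFColoring k H c

{-# OPTIONS --safe #-}
module Submission where

-- Edges with at most k uncoloured vertices take care of themselves, so only the
-- larger (live) ones matter.  Fix r.  If there are more than ∣U∣ r^k live edges on
-- the uncoloured set U, some vertex lies in more than r^k of them; it gets a colour
-- of its own, which settles these edges, so this happens at most m / r^k times.
-- Otherwise keeping each vertex with probability 1/(2r) and deleting a vertex from
-- every surviving edge gives an independent set I with ∣U∣ ≤ 4r ∣I∣; it gets one
-- colour, and about 4r log n such colours exhaust U.  An edge never lies inside such
-- an I while it is live, so its last colour class meets it in at most k vertices.
-- The two costs balance for r^(k+1) log n ≈ m.  If m < log n then r = 0, and one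
-- private vertex for each edge suffices.

open import Defs
open import Data.Nat using (ℕ; _≤_; _<_; _*_; _^_; suc)
open import Data.Nat.Logarithm using (⌊log₂_⌋)
open import Data.Product using (∃; _×_)
open import Data.Bool using (if_then_else_)
open import Data.Empty using (⊥-elim)
open import Data.Fin using (Fin; zero; suc)
import Data.Fin as Fin
import Data.Fin.Properties as Fin
open import Data.Fin.Subset using (Subset; inside; outside; _∈_; _∉_; _⊆_; _∩_; _─_; _-_; ∣_∣; ⁅_⁆; ⊤; Nonempty)
open import Data.Fin.Subset.Properties
open import Data.List using (List; []; _∷_; length; map; filter; tabulate)
open import Data.List.Properties using (length-filter; length-map; length-tabulate; filter-notAll)
open import Data.List.Membership.Propositional using () renaming (_∈_ to _∈ᴸ_)
open import Data.List.Membership.Propositional.Properties using (∈-filter⁺; ∈-filter⁻; ∈-map⁺; ∈-map⁻; ∈-tabulate⁺)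
open import Data.List.Relation.Unary.Any using (here; there)
open import Data.Nat using (_+_; zero; z≤n; s≤s; NonZero; _≤?_; _<?_)
open import Data.Nat.Logarithm using (⌊log₂⌋-mono-≤; ⌊log₂[2^n]⌋≡n)
open import Data.Nat.Properties hiding (_≟_)
open import Data.Nat.Tactic.RingSolver using (solve-∀)
open import Data.Product using (_,_; proj₁; proj₂)
open import Data.Vec using ([]; _∷_; here; there)
open import Data.Vec.Properties using (lookup∘tabulate; []=⇒lookup; lookup⇒[]=)
open import Level using (0ℓ)
open import Relation.Nullary using (¬_; yes; no; does; ¬?; contradiction)
open import Relation.Nullary.Decidable using (dec-true; isYes≗does)
open import Relation.Unary using (Pred; Decidable)
open import Relation.Binary.PropositionalEquality using (_≡_; refl; sym; trans; cong; cong₂; subst)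

private
  variable
    k n t : ℕ

-- Counting in filtered lists and finite subsets.

module _ {A : Set} {P Q : Pred A 0ℓ} (P? : Decidable P) (Q? : Decidable Q) where

  -- Only elements satisfying both predicates count twice on the left. For `avoiding`, this says
  -- that the degree of a vertex in a filtered list of edges is at most its degree in the whole
  -- list.
  length-filter-submodular : ∀ xs → length (filter P? xs) + length (filter Q? xs)
    ≤ length xs + length (filter P? (filter Q? xs))
  length-filter-submodular [] = z≤n
  length-filter-submodular (x ∷ xs) with ih ← length-filter-submodular xs | Q? x
  ... | yes _ with P? x
  ...   | yes _ rewrite +-suc (length (filter P? xs)) (length (filter Q? xs))
                      | +-suc (length xs) (length (filter P? (filter Q? xs))) = s≤s (s≤s ih)
  ...   | no _ rewrite +-suc (length (filter P? xs)) (length (filter Q? xs)) = s≤s ih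
  length-filter-submodular (x ∷ xs) | no _ with P? x
  ...   | yes _ = s≤s ih
  ...   | no _ = m≤n⇒m≤1+n ih

x∈p─q⇒x∉q : ∀ (p q : Subset n) {x} → x ∈ p ─ q → x ∉ q
x∈p─q⇒x∉q (_ ∷ p) (outside ∷ q) here ()
x∈p─q⇒x∉q (_ ∷ p) (inside  ∷ q) (there x∈p─q) (there x∈q) = x∈p─q⇒x∉q p q x∈p─q x∈q
x∈p─q⇒x∉q (_ ∷ p) (outside ∷ q) (there x∈p─q) (there x∈q) = x∈p─q⇒x∉q p q x∈p─q x∈q

∣p─q∣+∣p∩q∣≡∣p∣ : ∀ (p q : Subset n) → ∣ p ─ q ∣ + ∣ p ∩ q ∣ ≡ ∣ p ∣
∣p─q∣+∣p∩q∣≡∣p∣ [] [] = refl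
∣p─q∣+∣p∩q∣≡∣p∣ (outside ∷ p) (outside ∷ q) = ∣p─q∣+∣p∩q∣≡∣p∣ p q
∣p─q∣+∣p∩q∣≡∣p∣ (outside ∷ p) (inside ∷ q) = ∣p─q∣+∣p∩q∣≡∣p∣ p q
∣p─q∣+∣p∩q∣≡∣p∣ (inside ∷ p) (outside ∷ q) = cong suc (∣p─q∣+∣p∩q∣≡∣p∣ p q)
∣p─q∣+∣p∩q∣≡∣p∣ (inside ∷ p) (inside ∷ q) =
  trans (+-suc ∣ p ─ q ∣ ∣ p ∩ q ∣) (cong suc (∣p─q∣+∣p∩q∣≡∣p∣ p q))

q⊆p⇒∣p─q∣+∣q∣≤∣p∣ : ∀ {p q : Subset n} → q ⊆ p → ∣ p ─ q ∣ + ∣ q ∣ ≤ ∣ p ∣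
q⊆p⇒∣p─q∣+∣q∣≤∣p∣ {p = p} {q} q⊆p = begin
  ∣ p ─ q ∣ + ∣ q ∣      ≤⟨ +-monoʳ-≤ ∣ p ─ q ∣ (p⊆q⇒∣p∣≤∣q∣ λ x∈q → x∈p∩q⁺ (q⊆p x∈q , x∈q)) ⟩
  ∣ p ─ q ∣ + ∣ p ∩ q ∣  ≡⟨ ∣p─q∣+∣p∩q∣≡∣p∣ p q ⟩
  ∣ p ∣                  ∎
  where open ≤-Reasoning

∣p∣≤1+∣p-x∣ : ∀ (p : Subset n) x → ∣ p ∣ ≤ suc ∣ p - x ∣
∣p∣≤1+∣p-x∣ p x = begin
  ∣ p ∣                        ≡⟨ ∣p─q∣+∣p∩q∣≡∣p∣ p ⁅ x ⁆ ⟨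
  ∣ p - x ∣ + ∣ p ∩ ⁅ x ⁆ ∣    ≤⟨ +-monoʳ-≤ ∣ p - x ∣ (∣p∩q∣≤∣q∣ p ⁅ x ⁆) ⟩
  ∣ p - x ∣ + ∣ ⁅ x ⁆ ∣        ≡⟨ cong (∣ p - x ∣ +_) (∣⁅x⁆∣≡1 x) ⟩
  ∣ p - x ∣ + 1                ≡⟨ +-comm ∣ p - x ∣ 1 ⟩
  suc ∣ p - x ∣                ∎
  where open ≤-Reasoning

x∈p⇒0<∣p∣ : ∀ {p : Subset n} {x} → x ∈ p → 0 < ∣ p ∣
x∈p⇒0<∣p∣ x∈p = m<n⇒0<n (x∈p⇒∣p-x∣<∣p∣ x∈p)

0<∣p∣⇒Nonempty : ∀ {p : Subset n} → 0 < ∣ p ∣ → Nonempty p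
0<∣p∣⇒Nonempty {n} {p} 0<∣p∣ with nonempty? p
... | yes ne = ne
... | no e = contradiction 0<∣p∣ (<-irrefl (sym (trans (cong ∣_∣ (Empty-unique e)) (∣⊥∣≡0 n))))

-- Expectations over random subsets.

-- (q + 1) ^ n times the expectation of f over the random subset that keeps every
-- element independently with probability 1 / (q + 1).
weightedSum : ℕ → (Subset n → ℕ) → ℕ
weightedSum {zero}  q f = f []
weightedSum {suc n} q f = weightedSum q (λ W → f (inside ∷ W)) + q * weightedSum q (λ W → f (outside ∷ W))

module _ (q : ℕ) where

  private
    E : (Subset n → ℕ) → ℕ
    E = weightedSum q

  weightedSum-const : ∀ n a → E {n} (λ _ → a) ≡ a * suc q ^ n
  weightedSum-const zero a = sym (*-identityʳ a)
  weightedSum-const (suc n) a rewrite weightedSum-const n a = lemma a q (suc q ^ n)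
    where
    lemma : ∀ a q x → a * x + q * (a * x) ≡ a * (suc q * x)
    lemma = solve-∀

  weightedSum-+ : ∀ (f g : Subset n → ℕ) → E (λ W → f W + g W) ≡ E f + E g
  weightedSum-+ {zero} f g = refl
  weightedSum-+ {suc n} f g
    rewrite weightedSum-+ (λ W → f (inside ∷ W)) (λ W → g (inside ∷ W))
          | weightedSum-+ (λ W → f (outside ∷ W)) (λ W → g (outside ∷ W))
    = lemma q (E (λ W → f (inside ∷ W))) (E (λ W → g (inside ∷ W))) (E (λ W → f (outside ∷ W))) (E (λ W → g (outside ∷ W)))
    where
    lemma : ∀ q a b c d → a + b + q * (c + d) ≡ a + q * c + (b + q * d)
    lemma = solve-∀

  weightedSum-* : ∀ a (f : Subset n → ℕ) → E (λ W → a * f W) ≡ a * E f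
  weightedSum-* {zero} a f = refl
  weightedSum-* {suc n} a f
    rewrite weightedSum-* a (λ W → f (inside ∷ W))
          | weightedSum-* a (λ W → f (outside ∷ W))
    = lemma q a (E (λ W → f (inside ∷ W))) (E (λ W → f (outside ∷ W)))
    where
    lemma : ∀ q a b c → a * b + q * (a * c) ≡ a * (b + q * c)
    lemma = solve-∀

  -- By linearity, each element of `U` contributes its probability `1 / (q + 1)` of being kept; the
  -- factor `suc q` clears the denominator.
  weightedSum-∣∩∣ : ∀ (U : Subset n) → suc q * E (λ W → ∣ W ∩ U ∣) ≡ ∣ U ∣ * suc q ^ n
  weightedSum-∣∩∣ [] = *-zeroʳ q
  weightedSum-∣∩∣ {suc n} (outside ∷ U) = trans (lemma₁ q (E (λ W → ∣ W ∩ U ∣)))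
    (trans (cong (suc q *_) (weightedSum-∣∩∣ U)) (lemma₂ q ∣ U ∣ (suc q ^ n)))
    where
    lemma₁ : ∀ q a → suc q * (a + q * a) ≡ suc q * (suc q * a)
    lemma₁ = solve-∀
    lemma₂ : ∀ q u x → suc q * (u * x) ≡ u * (suc q * x)
    lemma₂ = solve-∀
  weightedSum-∣∩∣ {suc n} (inside ∷ U)
    rewrite weightedSum-+ (λ _ → 1) (λ W → ∣ W ∩ U ∣) | weightedSum-const n 1
    = trans (lemma₁ q (E (λ W → ∣ W ∩ U ∣)) (suc q ^ n))
    (trans (cong (λ z → suc q * (suc q ^ n + z)) (weightedSum-∣∩∣ U)) (lemma₂ q ∣ U ∣ (suc q ^ n)))
    where
    lemma₁ : ∀ q a x → suc q * (1 * x + a + q * a) ≡ suc q * (x + suc q * a)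
    lemma₁ = solve-∀
    lemma₂ : ∀ q u x → suc q * (x + u * x) ≡ suc u * (suc q * x)
    lemma₂ = solve-∀

  -- The method of conditional expectations: the inequality persists in at least one branch of the
  -- first coordinate.
  weightedSum-≤⇒∃≤ : ∀ (f g : Subset n → ℕ) → E f ≤ E g → ∃ λ W → f W ≤ g W
  weightedSum-≤⇒∃≤ {zero} f g Ef≤Eg = [] , Ef≤Eg
  weightedSum-≤⇒∃≤ {suc n} f g Ef≤Eg
    with E (λ W → f (inside ∷ W)) ≤? E (λ W → g (inside ∷ W))
       | E (λ W → f (outside ∷ W)) ≤? E (λ W → g (outside ∷ W))
  ... | yes le | _ = let W , fW≤gW = weightedSum-≤⇒∃≤ _ _ le in inside ∷ W , fW≤gW
  ... | no _ | yes le = let W , fW≤gW = weightedSum-≤⇒∃≤ _ _ le in outside ∷ W , fW≤gW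
  -- Strictness comes from the `inside` branch, which has weight 1; the weight `q` of the other
  -- branch may be 0.
  ... | no ≰₁ | no ≰₂ = contradiction Ef≤Eg
    (<⇒≱ (+-mono-<-≤ (≰⇒> ≰₁) (*-monoʳ-≤ q (<⇒≤ (≰⇒> ≰₂)))))

-- Independent sets by random sampling and deletion.

containment : Subset n → Subset n → ℕ
containment []            []            = 1
containment (outside ∷ S) (_ ∷ W)       = containment S W
containment (inside ∷ S)  (inside ∷ W)  = containment S W
containment (inside ∷ S)  (outside ∷ W) = 0

⊆⇒containment≡1 : ∀ {S W : Subset n} → S ⊆ W → containment S W ≡ 1
⊆⇒containment≡1 {S = []} {[]} S⊆W = refl
⊆⇒containment≡1 {S = outside ∷ S} {_ ∷ W} S⊆W = ⊆⇒containment≡1 (drop-∷-⊆ S⊆W)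
⊆⇒containment≡1 {S = inside ∷ S} {inside ∷ W} S⊆W = ⊆⇒containment≡1 (drop-∷-⊆ S⊆W)
⊆⇒containment≡1 {S = inside ∷ S} {outside ∷ W} S⊆W with () ← S⊆W here

-- `containment S` is the indicator of `S ⊆ W`. Each coordinate in `S` is forced to be `inside` and
-- costs a factor `1 / (q + 1)`; the others are free.
weightedSum-containment : ∀ q (S : Subset n) → suc q ^ ∣ S ∣ * weightedSum q (containment S) ≡ suc q ^ n
weightedSum-containment q [] = refl
weightedSum-containment {suc n} q (outside ∷ S) =
  trans (lemma q (suc q ^ ∣ S ∣) (weightedSum q (containment S))) (cong (suc q *_) (weightedSum-containment q S))
  where
  lemma : ∀ q x a → x * (a + q * a) ≡ suc q * (x * a)
  lemma = solve-∀
weightedSum-containment {suc n} q (inside ∷ S)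
  rewrite weightedSum-const q n 0 | *-zeroʳ q | +-identityʳ (weightedSum q (containment S)) =
  trans (*-assoc (suc q) (suc q ^ ∣ S ∣) _) (cong (suc q *_) (weightedSum-containment q S))

containedCount : List (Subset n) → Subset n → ℕ
containedCount []      W = 0
containedCount (S ∷ L) W = containment S W + containedCount L W

weightedSum-containedCount : ∀ q s (L : List (Subset n)) → (∀ {S} → S ∈ᴸ L → s ≤ ∣ S ∣) →
  suc q ^ s * weightedSum q (containedCount L) ≤ length L * suc q ^ n
weightedSum-containedCount {n} q s [] _ rewrite weightedSum-const q n 0 | *-zeroʳ (suc q ^ s) = z≤n
weightedSum-containedCount {n} q s (S ∷ L) large
  rewrite weightedSum-+ q (containment S) (containedCount L)
        | *-distribˡ-+ (suc q ^ s) (weightedSum q (containment S)) (weightedSum q (containedCount L))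
  = +-mono-≤
      (≤-trans (*-monoˡ-≤ (weightedSum q (containment S)) (^-monoʳ-≤ (suc q) (large (here refl))))
               (≤-reflexive (weightedSum-containment q S)))
      (weightedSum-containedCount q s L (λ S∈L → large (there S∈L)))

-- Edges are treated one at a time, and one that still lies inside `I` loses a vertex. It lies
-- inside `J` as well, so its summand 1 in `containedCount L J` pays for the deletion.
delete-contained : ∀ (L : List (Subset n)) → (∀ {S} → S ∈ᴸ L → Nonempty S) → ∀ J →
  ∃ λ I → I ⊆ J × ∣ J ∣ ≤ ∣ I ∣ + containedCount L J × (∀ {S} → S ∈ᴸ L → ¬ S ⊆ I)
delete-contained [] _ J = J , (λ x → x) , m≤m+n ∣ J ∣ 0 , λ ()
delete-contained (S ∷ L) ne J
  with I , I⊆J , ∣J∣≤ , indep ← delete-contained L (λ S∈L → ne (there S∈L)) J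
  with S ⊆? I
... | no S⊈I = I , I⊆J , ≤-trans ∣J∣≤ (+-monoʳ-≤ ∣ I ∣ (m≤n+m _ (containment S J)))
             , λ { (here refl) → S⊈I ; (there S∈L) → indep S∈L }
... | yes S⊆I with x , x∈S ← ne (here refl)
  = I - x , (λ y → I⊆J (p─q⊆p I ⁅ x ⁆ y)) , bound
  , λ { (here refl) S⊆I-x → x∈p─q⇒x∉q I ⁅ x ⁆ (S⊆I-x x∈S) (x∈⁅x⁆ x)
      ; (there S∈L) S⊆I-x → indep S∈L (λ y → p─q⊆p I ⁅ x ⁆ (S⊆I-x y)) }
  where
  open ≤-Reasoning
  bound : ∣ J ∣ ≤ ∣ I - x ∣ + (containment S J + containedCount L J)
  bound = begin
    ∣ J ∣                                                 ≤⟨ ∣J∣≤ ⟩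
    ∣ I ∣ + containedCount L J                            ≤⟨ +-monoˡ-≤ _ (∣p∣≤1+∣p-x∣ I x) ⟩
    suc ∣ I - x ∣ + containedCount L J                    ≡⟨ +-suc ∣ I - x ∣ _ ⟨
    ∣ I - x ∣ + (1 + containedCount L J)                  ≡⟨ cong (λ z → ∣ I - x ∣ + (z + containedCount L J)) (⊆⇒containment≡1 (λ y → I⊆J (S⊆I y))) ⟨
    ∣ I - x ∣ + (containment S J + containedCount L J)    ∎

-- `weightedSum` samples from all `n` vertices, while the independent set has to be cut out of `U`.
containment-∩ : ∀ {S U : Subset n} W → S ⊆ U → containment S (W ∩ U) ≡ containment S W
containment-∩ {S = []} {[]} [] _ = refl
containment-∩ {S = outside ∷ S} {_ ∷ U} (_ ∷ W) S⊆U = containment-∩ W (drop-∷-⊆ S⊆U)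
containment-∩ {S = inside ∷ S} {inside ∷ U} (inside ∷ W) S⊆U = containment-∩ W (drop-∷-⊆ S⊆U)
containment-∩ {S = inside ∷ S} {inside ∷ U} (outside ∷ W) S⊆U = refl
containment-∩ {S = inside ∷ S} {outside ∷ U} (_ ∷ W) S⊆U with () ← S⊆U here

containedCount-∩ : ∀ {U : Subset n} (L : List (Subset n)) W → (∀ {S} → S ∈ᴸ L → S ⊆ U) →
  containedCount L (W ∩ U) ≡ containedCount L W
containedCount-∩ [] W _ = refl
containedCount-∩ (S ∷ L) W ⊆U =
  cong₂ _+_ (containment-∩ W (⊆U (here refl))) (containedCount-∩ L W (λ S∈L → ⊆U (there S∈L)))

-- The list holds the traces of the edges on the uncoloured set `U`.
record Live (k : ℕ) (U : Subset n) (L : List (Subset n)) : Set where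
  field
    within : ∀ {S} → S ∈ᴸ L → S ⊆ U
    large  : ∀ {S} → S ∈ᴸ L → k < ∣ S ∣

  nonempty : ∀ {S} → S ∈ᴸ L → Nonempty S
  nonempty S∈L = 0<∣p∣⇒Nonempty (≤-<-trans z≤n (large S∈L))

2*r^k≤[2*r]^k : ∀ r → 1 ≤ k → 2 * r ^ k ≤ (2 * r) ^ k
2*r^k≤[2*r]^k {suc zero} r _ = ≤-reflexive (lemma r)
  where
  lemma : ∀ r → 2 * (r * 1) ≡ 2 * r * 1
  lemma = solve-∀
2*r^k≤[2*r]^k {suc (suc k)} r _ = begin
  2 * (r * r ^ suc k)              ≡⟨ lemma r (r ^ suc k) ⟩
  r * (2 * r ^ suc k)              ≤⟨ *-mono-≤ (m≤n*m r 2) (2*r^k≤[2*r]^k {suc k} r (s≤s z≤n)) ⟩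
  2 * r * (2 * r) ^ suc k          ∎
  where
  open ≤-Reasoning
  lemma : ∀ r x → 2 * (r * x) ≡ r * (2 * x)
  lemma = solve-∀

-- Keep each vertex with probability `1 / R`, where `R = 2 * r`. Live edges have at least `k + 1`
-- vertices, so the expected number inside the sample is at most `∣ U ∣ * r ^ k / R ^ (k + 1) ≤ ∣ U
-- ∣ / (2 * R)`, half the expected size of the sample. Some sample thus keeps `∣ U ∣ / (4 * r)`
-- vertices after the deletions.
large-independent : ∀ r .{{_ : NonZero r}} → 1 ≤ k → ∀ (U : Subset n) L → Live k U L →
  length L ≤ ∣ U ∣ * r ^ k →
  ∃ λ I → I ⊆ U × ∣ U ∣ ≤ 4 * r * ∣ I ∣ × (∀ {S} → S ∈ᴸ L → ¬ S ⊆ I)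
large-independent {k} {n} r@(suc r′) 1≤k U L live e≤ = go (weightedSum-≤⇒∃≤ q f g Ef≤Eg)
  where
  open Live live
  open ≤-Reasoning
  q R u Ec : ℕ
  -- With this choice `suc q` reduces to `2 * r`, that is, to `R`.
  q = r′ + (r + 0)
  R = 2 * r
  u = ∣ U ∣
  Ec = weightedSum q (containedCount L)
  f g : Subset n → ℕ
  -- `f W ≤ g W` says, without subtraction or division, that the sample exceeds the number of
  -- contained edges by at least `u / (2 * R)`.
  f W = u + 2 * R * containedCount L W
  g W = 2 * R * ∣ W ∩ U ∣

  instance
    R^k≢0 : NonZero (R ^ k)
    R^k≢0 = m^n≢0 R k

  lemma₁ : ∀ x R c → x * (2 * R * c) ≡ 2 * (R * x * c)
  lemma₁ = solve-∀
  lemma₂ : ∀ u x y → 2 * (u * x * y) ≡ 2 * x * (u * y)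
  lemma₂ = solve-∀
  lemma₃ : ∀ u y → u * y + u * y ≡ 2 * (u * y)
  lemma₃ = solve-∀

  2REc≤ : 2 * R * Ec ≤ u * R ^ n
  2REc≤ = *-cancelˡ-≤ (R ^ k) (begin
    R ^ k * (2 * R * Ec)        ≡⟨ lemma₁ (R ^ k) R Ec ⟩
    2 * (R ^ suc k * Ec)        ≤⟨ *-monoʳ-≤ 2 (weightedSum-containedCount q (suc k) L large) ⟩
    2 * (length L * R ^ n)      ≤⟨ *-monoʳ-≤ 2 (*-monoˡ-≤ (R ^ n) e≤) ⟩
    2 * (u * r ^ k * R ^ n)     ≡⟨ lemma₂ u (r ^ k) (R ^ n) ⟩
    2 * r ^ k * (u * R ^ n)     ≤⟨ *-monoˡ-≤ (u * R ^ n) (2*r^k≤[2*r]^k r 1≤k) ⟩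
    R ^ k * (u * R ^ n)         ∎)

  Ef≤Eg : weightedSum q f ≤ weightedSum q g
  Ef≤Eg = begin
    weightedSum q f
      ≡⟨ weightedSum-+ q (λ _ → u) (λ W → 2 * R * containedCount L W) ⟩
    weightedSum {n} q (λ _ → u) + weightedSum q (λ W → 2 * R * containedCount L W)
      ≡⟨ cong₂ _+_ (weightedSum-const q n u) (weightedSum-* q (2 * R) (containedCount L)) ⟩
    u * R ^ n + 2 * R * Ec                    ≤⟨ +-monoʳ-≤ (u * R ^ n) 2REc≤ ⟩
    u * R ^ n + u * R ^ n                     ≡⟨ lemma₃ u (R ^ n) ⟩
    2 * (u * R ^ n)                           ≡⟨ cong (2 *_) (weightedSum-∣∩∣ q U) ⟨
    2 * (R * weightedSum q (λ W → ∣ W ∩ U ∣)) ≡⟨ *-assoc 2 R _ ⟨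
    2 * R * weightedSum q (λ W → ∣ W ∩ U ∣)   ≡⟨ weightedSum-* q (2 * R) (λ W → ∣ W ∩ U ∣) ⟨
    weightedSum q g                           ∎

  go : (∃ λ W → f W ≤ g W) → ∃ λ I → I ⊆ U × ∣ U ∣ ≤ 4 * r * ∣ I ∣ × (∀ {S} → S ∈ᴸ L → ¬ S ⊆ I)
  go (W , fW≤gW) with I , I⊆J , ∣J∣≤ , indep ← delete-contained L nonempty (W ∩ U)
    rewrite containedCount-∩ L W within
    = I , (λ x → p∩q⊆q W U (I⊆J x)) , +-cancelʳ-≤ (2 * R * containedCount L W) _ _ bound , indep
    where
    lemma₄ : ∀ r i c → 2 * (2 * r) * (i + c) ≡ 4 * r * i + 2 * (2 * r) * c
    lemma₄ = solve-∀
    bound : u + 2 * R * containedCount L W ≤ 4 * r * ∣ I ∣ + 2 * R * containedCount L W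
    bound = begin
      u + 2 * R * containedCount L W                 ≤⟨ fW≤gW ⟩
      2 * R * ∣ W ∩ U ∣                              ≤⟨ *-monoʳ-≤ (2 * R) ∣J∣≤ ⟩
      2 * R * (∣ I ∣ + containedCount L W)           ≡⟨ lemma₄ r ∣ I ∣ (containedCount L W) ⟩
      4 * r * ∣ I ∣ + 2 * R * containedCount L W     ∎

-- Vertices of high degree.

avoiding : Fin n → List (Subset n) → List (Subset n)
avoiding v = filter (λ S → ¬? (v ∈? S))

-- Pigeonhole by induction on `u`: take a vertex `v` of some edge. If at most `D` edges contain it,
-- the others lie in `U - v` and number more than `(u - 1) * D`, so some vertex has high degree
-- among them and hence in `L`.
high-degree-vertex : ∀ D u (U : Subset n) L → ∣ U ∣ ≤ u →
  (∀ {S} → S ∈ᴸ L → S ⊆ U) → (∀ {S} → S ∈ᴸ L → Nonempty S) →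
  u * D < length L → ∃ λ v → length (avoiding v L) + D < length L
high-degree-vertex D u U (S ∷ L₀) ∣U∣≤u ⊆U ne uD<∣L∣
  with v , v∈S ← ne (here refl)
  with u | length (avoiding v (S ∷ L₀)) + D <? length (S ∷ L₀)
... | zero  | _ = contradiction (x∈p⇒0<∣p∣ (⊆U (here refl) v∈S)) (≤⇒≯ ∣U∣≤u)
... | suc u | yes high = v , high
... | suc u | no ¬high = v′ , +-cancelʳ-< (length L′) _ _ (begin-strict
    length (avoiding v′ L) + D + length L′         ≡⟨ lemma (length (avoiding v′ L)) D (length L′) ⟩
    length (avoiding v′ L) + length L′ + D         ≤⟨ +-monoˡ-≤ D (length-filter-submodular (λ S → ¬? (v′ ∈? S)) (λ S → ¬? (v ∈? S)) L) ⟩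
    length L + length (avoiding v′ L′) + D         ≡⟨ +-assoc (length L) _ D ⟩
    length L + (length (avoiding v′ L′) + D)       <⟨ +-monoʳ-< (length L) high′ ⟩
    length L + length L′                           ∎)
  where
  open ≤-Reasoning
  L L′ : List (Subset _)
  L = S ∷ L₀
  L′ = avoiding v L
  lemma : ∀ a b c → a + b + c ≡ a + c + b
  lemma = solve-∀
  v∈U : v ∈ U
  v∈U = ⊆U (here refl) v∈S
  uD<∣L′∣ : u * D < length L′
  uD<∣L′∣ = +-cancelʳ-< D _ _ (begin-strict
    u * D + D         ≡⟨ +-comm (u * D) D ⟩
    suc u * D         <⟨ uD<∣L∣ ⟩
    length L          ≤⟨ ≮⇒≥ ¬high ⟩
    length L′ + D     ∎)
  unavoiding : ∀ {T} → T ∈ᴸ L′ → T ∈ᴸ L × v ∉ T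
  unavoiding = ∈-filter⁻ (λ S → ¬? (v ∈? S)) {xs = L}
  rec : ∃ λ v′ → length (avoiding v′ L′) + D < length L′
  rec = high-degree-vertex D u (U - v) L′
    (≤-pred (≤-trans (x∈p⇒∣p-x∣<∣p∣ v∈U) ∣U∣≤u))
    (λ T∈L′ x∈T → let T∈L , v∉T = unavoiding T∈L′ in
      x∈p∧x≢y⇒x∈p-y (⊆U T∈L x∈T) (λ { refl → v∉T x∈T }))
    (λ T∈L′ → ne (proj₁ (unavoiding T∈L′)))
    uD<∣L′∣
  v′ = proj₁ rec
  high′ = proj₂ rec

-- Colourings built one class at a time.

Handled : ℕ → (Fin n → Fin t) → Subset n → Set
Handled {t = t} k c S = ∃ λ (i : Fin t) → 1 ≤ ∣ S ∩ colorClass c i ∣ × ∣ S ∩ colorClass c i ∣ ≤ k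

-- `T` is only an upper bound, since the recursion may stop with part of its budget unspent.
Colorable : ℕ → List (Subset n) → ℕ → Set
Colorable {n} k L T = ∃ λ t → t ≤ T × ∃ λ (c : Fin n → Fin t) → ∀ {S} → S ∈ᴸ L → Handled k c S

Colorable-mono : ∀ {L : List (Subset n)} {T T′} → T ≤ T′ → Colorable k L T → Colorable k L T′
Colorable-mono T≤T′ (t , t≤T , c) = t , ≤-trans t≤T T≤T′ , c

∈colorClass⁺ : ∀ (c : Fin n → Fin t) {v i} → c v ≡ i → v ∈ colorClass c i
∈colorClass⁺ c {v} {i} cv≡i = lookup⇒[]= v _ (trans (lookup∘tabulate _ v) (trans (isYes≗does (c v Fin.≟ i)) (dec-true (c v Fin.≟ i) cv≡i)))

∈colorClass⁻ : ∀ (c : Fin n → Fin t) {v i} → v ∈ colorClass c i → c v ≡ i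
∈colorClass⁻ c {v} {i} v∈ with eq ← trans (sym (lookup∘tabulate _ v)) ([]=⇒lookup v∈) with c v Fin.≟ i
... | yes cv≡i = cv≡i
... | no _ with () ← eq

small⇒Handled : ∀ (c : Fin n → Fin t) {S} → Nonempty S → ∣ S ∣ ≤ k → Handled k c S
small⇒Handled c {S} (v , v∈S) ∣S∣≤k =
  c v , x∈p⇒0<∣p∣ (x∈p∩q⁺ (v∈S , ∈colorClass⁺ c refl)) , ≤-trans (∣p∩q∣≤∣p∣ S _) ∣S∣≤k

-- Partial colourings are represented by total ones: whatever `c` says on `I` is overwritten.
extend : Subset n → (Fin n → Fin t) → Fin n → Fin (suc t)
extend I c v = if does (v ∈? I) then zero else suc (c v)

module _ (I : Subset n) (c : Fin n → Fin t) where

  extend-∈ : ∀ {v} → v ∈ I → extend I c v ≡ zero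
  extend-∈ {v} v∈I rewrite dec-true (v ∈? I) v∈I = refl

  extend-∉ : ∀ {v} → v ∉ I → extend I c v ≡ suc (c v)
  extend-∉ {v} v∉I with v ∈? I
  ... | yes v∈I = contradiction v∈I v∉I
  ... | no _ = refl

  colorClass-extend-zero : colorClass (extend I c) zero ≡ I
  colorClass-extend-zero = ⊆-antisym ⊆I (λ v∈I → ∈colorClass⁺ (extend I c) (extend-∈ v∈I))
    where
    ⊆I : colorClass (extend I c) zero ⊆ I
    ⊆I {v} v∈ with v ∈? I
    ... | yes v∈I = v∈I
    ... | no v∉I with () ← trans (sym (extend-∉ v∉I)) (∈colorClass⁻ (extend I c) v∈)

  ∩-colorClass-extend-suc : ∀ S i → S ∩ colorClass (extend I c) (suc i) ≡ (S ─ I) ∩ colorClass c i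
  ∩-colorClass-extend-suc S i = ⊆-antisym to from
    where
    to : S ∩ colorClass (extend I c) (suc i) ⊆ (S ─ I) ∩ colorClass c i
    to {v} v∈ with v∈S , v∈i ← x∈p∩q⁻ S _ v∈ with v ∈? I
    ... | yes v∈I with () ← trans (sym (extend-∈ v∈I)) (∈colorClass⁻ (extend I c) v∈i)
    ... | no v∉I = x∈p∩q⁺ (x∈p∧x∉q⇒x∈p─q v∈S v∉I , ∈colorClass⁺ c
            (Fin.suc-injective (trans (sym (extend-∉ v∉I)) (∈colorClass⁻ (extend I c) v∈i))))
    from : (S ─ I) ∩ colorClass c i ⊆ S ∩ colorClass (extend I c) (suc i)
    from {v} v∈ with v∈S─I , v∈i ← x∈p∩q⁻ (S ─ I) _ v∈ =
      x∈p∩q⁺ (p─q⊆p S I v∈S─I , ∈colorClass⁺ (extend I c)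
        (trans (extend-∉ (x∈p─q⇒x∉q S I v∈S─I)) (cong suc (∈colorClass⁻ c v∈i))))

  Handled-extend-new : ∀ S → 1 ≤ ∣ S ∩ I ∣ → ∣ S ∩ I ∣ ≤ k → Handled k (extend I c) S
  Handled-extend-new {k} S 1≤ ≤k =
    zero , subst (λ X → 1 ≤ ∣ S ∩ X ∣ × ∣ S ∩ X ∣ ≤ k) (sym colorClass-extend-zero) (1≤ , ≤k)

  Handled-extend-old : ∀ S → Handled k c (S ─ I) → Handled k (extend I c) S
  Handled-extend-old {k} S (i , p) =
    suc i , subst (λ X → 1 ≤ ∣ X ∣ × ∣ X ∣ ≤ k) (sym (∩-colorClass-extend-suc S i)) p

-- Edges that remain after colouring a set.

residual : ℕ → Subset n → List (Subset n) → List (Subset n)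
residual k I L = filter (λ S → k <? ∣ S ∣) (map (_─ I) L)

length-residual : ∀ k (I : Subset n) L → length (residual k I L) ≤ length L
length-residual k I L = ≤-trans (length-filter _ (map (_─ I) L)) (≤-reflexive (length-map _ L))

Live-residual : ∀ {U : Subset n} {L} I → Live k U L → Live k (U ─ I) (residual k I L)
Live-residual {k = k} {U} {L} I live = record { within = within′ ; large = λ S∈ → proj₂ (∈-filter⁻ big? {xs = map (_─ I) L} S∈) }
  where
  open Live live
  big? = λ S → k <? ∣ S ∣
  within′ : ∀ {S} → S ∈ᴸ residual k I L → S ⊆ U ─ I
  within′ S∈ x∈S with T , T∈L , refl ← ∈-map⁻ (_─ I) (proj₁ (∈-filter⁻ big? {xs = map (_─ I) L} S∈)) =
    x∈p∧x∉q⇒x∈p─q (within T∈L (p─q⊆p T I x∈S)) (x∈p─q⇒x∉q T I x∈S)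

-- A trace dropped by `residual` has at most `k` vertices, so the colour of any of them serves,
-- whatever `c` is. Nonemptiness of `S ─ I` excludes an edge swallowed by `I`, whose only colour
-- could occur more than `k` times.
Handled-residual : ∀ (I : Subset n) (c : Fin n → Fin t) L →
  (∀ {S} → S ∈ᴸ residual k I L → Handled k c S) →
  ∀ {S} → S ∈ᴸ L → Nonempty (S ─ I) → Handled k (extend I c) S
Handled-residual {k = k} I c L handled {S} S∈L ne with k <? ∣ S ─ I ∣
... | yes k< = Handled-extend-old I c S (handled (∈-filter⁺ (λ S → k <? ∣ S ∣) (∈-map⁺ (_─ I) S∈L) k<))
... | no k≮ = Handled-extend-old I c S (small⇒Handled c ne (≮⇒≥ k≮))

¬⊆⇒Nonempty─ : ∀ {S I : Subset n} → ¬ S ⊆ I → Nonempty (S ─ I)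
¬⊆⇒Nonempty─ {S = S} {I} S⊈I with nonempty? (S ─ I)
... | yes ne = ne
... | no empty = ⊥-elim (S⊈I S⊆I)
  where
  S⊆I : S ⊆ I
  S⊆I {x} x∈S with x ∈? I
  ... | yes x∈I = x∈I
  ... | no x∉I = contradiction (x , x∈p∧x∉q⇒x∈p─q x∈S x∉I) empty

-- Independence keeps `S ─ I` nonempty, so every edge is settled by a colour other than that of `I`.
color-independent : ∀ {L : List (Subset n)} {T} I → (∀ {S} → S ∈ᴸ L → ¬ S ⊆ I) →
  Colorable k (residual k I L) T → Colorable k L (suc T)
color-independent I indep (t , t≤T , c , handled) =
  suc t , s≤s t≤T , extend I c , λ S∈L → Handled-residual I c _ handled S∈L (¬⊆⇒Nonempty─ (indep S∈L))

-- An edge through `v` sees the new colour exactly once and can be forgotten; an edge avoiding `v`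
-- keeps all its vertices.
color-vertex : ∀ {L : List (Subset n)} {T} v → 1 ≤ k → (∀ {S} → S ∈ᴸ L → Nonempty S) →
  Colorable k (residual k ⁅ v ⁆ (avoiding v L)) T → Colorable k L (suc T)
color-vertex {n} {k} {L} v 1≤k nonempty (t , t≤T , c , handled) = suc t , s≤s t≤T , extend ⁅ v ⁆ c , handled′
  where
  handled′ : ∀ {S} → S ∈ᴸ L → Handled k (extend ⁅ v ⁆ c) S
  handled′ {S} S∈L with v ∈? S
  ... | yes v∈S = Handled-extend-new ⁅ v ⁆ c S (x∈p⇒0<∣p∣ (x∈p∩q⁺ (v∈S , x∈⁅x⁆ v)))
        (≤-trans (∣p∩q∣≤∣q∣ S ⁅ v ⁆) (≤-trans (≤-reflexive (∣⁅x⁆∣≡1 v)) 1≤k))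
  ... | no v∉S with x , x∈S ← nonempty S∈L =
        Handled-residual ⁅ v ⁆ c _ handled (∈-filter⁺ (λ S → ¬? (v ∈? S)) S∈L v∉S)
          (x , x∈p∧x≢y⇒x∈p-y x∈S λ { refl → v∉S x∈S })

Live-avoiding : ∀ {U : Subset n} {L} v → Live k U L → Live k U (avoiding v L)
Live-avoiding {L = L} v live = record { within = λ S∈ → within (back S∈) ; large = λ S∈ → large (back S∈) }
  where
  open Live live
  back : ∀ {S} → S ∈ᴸ avoiding v L → S ∈ᴸ L
  back S∈ = proj₁ (∈-filter⁻ (λ S → ¬? (v ∈? S)) {xs = L} S∈)

-- Each chosen vertex settles at least the first edge of the list; the extra colour is for the
-- vertices left at the end.
color-one-per-edge : 1 ≤ k → ∀ a {U : Subset n} L → Live k U L → length L ≤ a → Colorable k L (suc a)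
color-one-per-edge 1≤k a [] live _ = 1 , s≤s z≤n , (λ _ → zero) , λ ()
color-one-per-edge {k} 1≤k (suc a) L@(S ∷ L₀) live ∣L∣≤ with v , v∈S ← Live.nonempty live (here refl) =
  color-vertex v 1≤k (Live.nonempty live) (color-one-per-edge 1≤k a _ (Live-residual ⁅ v ⁆ (Live-avoiding v live))
    (≤-pred (≤-trans (s≤s (length-residual k ⁅ v ⁆ (avoiding v L)))
      (≤-trans (filter-notAll (λ S → ¬? (v ∈? S)) L (here (λ v∉S → v∉S v∈S))) ∣L∣≤))))

-- The recursion with its budget of colours.

module _ (r : ℕ) .{{_ : NonZero r}} {k : ℕ} (1≤k : 1 ≤ k) where

  -- At most a vertices are still coloured individually.  While ∣ U ∣ exceeds 2 ^ j, every
  -- independent set removes at least 2 ^ j / 4r vertices, so b more of them bring ∣ U ∣ down to 2 ^ j.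
  color-budget : ∀ a j b {U : Subset n} {L} → Live k U L → length L ≤ a * r ^ k →
    4 * r * ∣ U ∣ ≤ 2 ^ j * (4 * r + b) → Colorable k L (suc (a + (j * (4 * r) + b)))
  -- No live edge is left, and the one colour from the outer `suc` serves all remaining vertices.
  color-budget zero j b {L = []} live _ _ = 1 , s≤s z≤n , (λ _ → zero) , λ ()
  -- Here `∣ U ∣ ≤ 1`, while a live edge has more than `k ≥ 1` vertices, so none exists.
  color-budget (suc a) zero zero {U} {L} live _ ∣U∣≤ = 1 , s≤s z≤n , (λ _ → zero) , λ S∈L →
    contradiction (≤-trans (s≤s 1≤k) (≤-trans (Live.large live S∈L) (p⊆q⇒∣p∣≤∣q∣ (Live.within live S∈L)))) (<⇒≱ (s≤s ∣U∣≤1))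
    where
    instance
      4r≢0 : NonZero (4 * r)
      4r≢0 = m*n≢0 4 r
    lemma : ∀ x → 1 * (x + 0) ≡ x * 1
    lemma = solve-∀
    ∣U∣≤1 : ∣ U ∣ ≤ 1
    ∣U∣≤1 = *-cancelˡ-≤ (4 * r) (≤-trans ∣U∣≤ (≤-reflexive (lemma (4 * r))))
  -- A new phase halves the target: `2 ^ suc j * (4 * r) = 2 ^ j * (4 * r + 4 *
  -- r)`, so it starts with `b = 4 * r` and the total budget is unchanged.
  color-budget (suc a) (suc j) zero {U} {L} live ∣L∣≤ ∣U∣≤ =
    Colorable-mono (≤-reflexive (cong (λ z → suc (suc a + z)) (lemma₁ j (4 * r))))
      (color-budget (suc a) j (4 * r) live ∣L∣≤ (≤-trans ∣U∣≤ (≤-reflexive (lemma₂ (2 ^ j) (4 * r)))))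
    where
    lemma₁ : ∀ j x → j * x + x ≡ suc j * x + 0
    lemma₁ = solve-∀
    lemma₂ : ∀ y x → 2 * y * (x + 0) ≡ y * (x + x)
    lemma₂ = solve-∀
  color-budget (suc a) j (suc b) {U} {L} live ∣L∣≤ ∣U∣≤ with length L ≤? ∣ U ∣ * r ^ k
  -- More than `r ^ k` live edges contain `v` and disappear, which pays for lowering `a` by one.
  ... | no ≰ with v , high ← high-degree-vertex (r ^ k) ∣ U ∣ U L ≤-refl (Live.within live) (Live.nonempty live) (≰⇒> ≰) =
    color-vertex v 1≤k (Live.nonempty live)
      (color-budget a j (suc b) (Live-residual ⁅ v ⁆ (Live-avoiding v live))
        (≤-trans (length-residual k ⁅ v ⁆ (avoiding v L)) (+-cancelʳ-≤ (r ^ k) _ _ (begin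
          length (avoiding v L) + r ^ k   ≤⟨ <⇒≤ high ⟩
          length L                        ≤⟨ ∣L∣≤ ⟩
          r ^ k + a * r ^ k               ≡⟨ +-comm (r ^ k) _ ⟩
          a * r ^ k + r ^ k               ∎)))
        (≤-trans (*-monoʳ-≤ (4 * r) (∣p─q∣≤∣p∣ U ⁅ v ⁆)) ∣U∣≤))
    where open ≤-Reasoning
  ... | yes ∣L∣≤∣U∣r^k with I , I⊆U , ∣U∣≤4r∣I∣ , indep ← large-independent r 1≤k U L live ∣L∣≤∣U∣r^k =
    Colorable-mono (≤-reflexive (cong suc (sym (lemma₁ (suc a) (j * (4 * r)) b))))
      (color-independent I indep (color-budget (suc a) j b (Live-residual I live)
        (≤-trans (length-residual k I L) ∣L∣≤) shrink))
    where
    open ≤-Reasoning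
    lemma₁ : ∀ a x b → a + (x + suc b) ≡ suc (a + (x + b))
    lemma₁ = solve-∀
    lemma₂ : ∀ y x b → y * (x + suc b) ≡ y * (x + b) + y
    lemma₂ = solve-∀
    -- If `∣ U ∣ ≤ 2 ^ j`, the bound is automatic. Otherwise `2 ^ j ≤ ∣ U ∣ ≤ 4 * r * ∣ I ∣`, so
    -- removing `I` lowers `4 * r * ∣ U ∣` by at least `2 ^ j`, the price of one unit of `b`.
    shrink : 4 * r * ∣ U ─ I ∣ ≤ 2 ^ j * (4 * r + b)
    shrink with ∣ U ∣ ≤? 2 ^ j
    ... | yes ∣U∣≤2^j = begin
      4 * r * ∣ U ─ I ∣     ≤⟨ *-monoʳ-≤ (4 * r) (≤-trans (∣p─q∣≤∣p∣ U I) ∣U∣≤2^j) ⟩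
      4 * r * 2 ^ j         ≡⟨ *-comm (4 * r) (2 ^ j) ⟩
      2 ^ j * (4 * r)       ≤⟨ *-monoʳ-≤ (2 ^ j) (m≤m+n (4 * r) b) ⟩
      2 ^ j * (4 * r + b)   ∎
    ... | no ∣U∣≰2^j = +-cancelʳ-≤ (2 ^ j) _ _ (begin
      4 * r * ∣ U ─ I ∣ + 2 ^ j               ≤⟨ +-monoʳ-≤ _ (≤-trans (≰⇒≥ ∣U∣≰2^j) ∣U∣≤4r∣I∣) ⟩
      4 * r * ∣ U ─ I ∣ + 4 * r * ∣ I ∣       ≡⟨ *-distribˡ-+ (4 * r) ∣ U ─ I ∣ ∣ I ∣ ⟨
      4 * r * (∣ U ─ I ∣ + ∣ I ∣)             ≤⟨ *-monoʳ-≤ (4 * r) (q⊆p⇒∣p─q∣+∣q∣≤∣p∣ I⊆U) ⟩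
      4 * r * ∣ U ∣                           ≤⟨ ∣U∣≤ ⟩
      2 ^ j * (4 * r + suc b)                 ≡⟨ lemma₂ (2 ^ j) (4 * r) b ⟩
      2 ^ j * (4 * r + b) + 2 ^ j             ∎)

-- Choice of `r` and balancing of the costs.

n<2^[1+⌊log₂n⌋] : ∀ n → n < 2 ^ suc ⌊log₂ n ⌋
n<2^[1+⌊log₂n⌋] n = ≰⇒> λ le → 1+n≰n
  (subst (_≤ ⌊log₂ n ⌋) (⌊log₂[2^n]⌋≡n (suc ⌊log₂ n ⌋)) (⌊log₂⌋-mono-≤ le))

-- Search downwards from `N`: the first value at most `m` gives the crossing. It serves as an
-- integer root, `r = ⌊(m / ℓ) ^ (1 / (k + 1))⌋`.
last-below : ∀ (f : ℕ → ℕ) m N → f 0 ≤ m → m < f N → ∃ λ r → f r ≤ m × m < f (suc r)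
last-below f m zero f0≤m m<f0 = contradiction f0≤m (<⇒≱ m<f0)
last-below f m (suc N) f0≤m m<f with f N ≤? m
... | yes fN≤m = N , fN≤m , m<f
... | no fN≰m = last-below f m N f0≤m (≰⇒> fN≰m)

[m*n]^k≡m^k*n^k : ∀ m n k → (m * n) ^ k ≡ m ^ k * n ^ k
[m*n]^k≡m^k*n^k m n zero = refl
[m*n]^k≡m^k*n^k m n (suc k) rewrite [m*n]^k≡m^k*n^k m n k = lemma m n (m ^ k) (n ^ k)
  where
  lemma : ∀ m n x y → m * n * (x * y) ≡ m * x * (n * y)
  lemma = solve-∀

-- For `r ≥ 1` at the crossing, `m / r ^ k` is of order `r * ℓ` like the other cost, and
-- `(r * ℓ) ^ suc k ≤ m * ℓ ^ k`.
edge-list-bound : 1 ≤ k → ∀ n m → 2 ≤ n → 1 ≤ m → ∀ {L : List (Subset n)} → Live k ⊤ L → length L ≤ m →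
  ∃ λ T → Colorable k L T × T ^ suc k ≤ (2 ^ suc k + 9) ^ suc k * m * ⌊log₂ n ⌋ ^ k
edge-list-bound {k} 1≤k n m 2≤n 1≤m {L} live ∣L∣≤m =
  go (last-below (λ r → r ^ suc k * ℓ) m (suc m) z≤n m<)
  where
  open ≤-Reasoning
  ℓ c : ℕ
  ℓ = ⌊log₂ n ⌋
  -- In multiples of `r * ℓ`: `2 ^ suc k` for the individually coloured vertices, 4 for the `ℓ`
  -- phases, 4 for the initial `b = 4 * r`, and 1 for the spare colour.
  c = 2 ^ suc k + 9
  1≤ℓ : 1 ≤ ℓ
  1≤ℓ = ⌊log₂⌋-mono-≤ 2≤n

  m< : m < suc m ^ suc k * ℓ
  m< = begin-strict
    m                    <⟨ n<1+n m ⟩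
    suc m                ≡⟨ *-identityʳ (suc m) ⟨
    suc m * 1            ≤⟨ *-monoʳ-≤ (suc m) (m^n>0 (suc m) k) ⟩
    suc m ^ suc k        ≡⟨ *-identityʳ _ ⟨
    suc m ^ suc k * 1    ≤⟨ *-monoʳ-≤ (suc m ^ suc k) 1≤ℓ ⟩
    suc m ^ suc k * ℓ    ∎

  go : (∃ λ r → r ^ suc k * ℓ ≤ m × m < suc r ^ suc k * ℓ) →
       ∃ λ T → Colorable k L T × T ^ suc k ≤ c ^ suc k * m * ℓ ^ k
  -- Here `m < ℓ`: one factor of `m ^ suc k` is kept and the other `k` are bounded by `ℓ`.
  go (zero , _ , m<ℓ) = suc m , color-one-per-edge 1≤k m L live ∣L∣≤m , (begin
    suc m ^ suc k              ≤⟨ ^-monoˡ-≤ (suc k) 1+m≤cm ⟩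
    (c * m) ^ suc k            ≡⟨ [m*n]^k≡m^k*n^k c m (suc k) ⟩
    c ^ suc k * (m * m ^ k)    ≡⟨ *-assoc (c ^ suc k) m (m ^ k) ⟨
    c ^ suc k * m * m ^ k      ≤⟨ *-monoʳ-≤ (c ^ suc k * m) (^-monoˡ-≤ k m≤ℓ) ⟩
    c ^ suc k * m * ℓ ^ k      ∎)
    where
    m≤ℓ : m ≤ ℓ
    m≤ℓ = <⇒≤ (subst (m <_) (trans (cong (_* ℓ) (^-zeroˡ (suc k))) (*-identityˡ ℓ)) m<ℓ)
    lemma : ∀ m → m + m ≡ 2 * m
    lemma = solve-∀
    1+m≤cm : suc m ≤ c * m
    1+m≤cm = begin
      1 + m   ≤⟨ +-monoˡ-≤ m 1≤m ⟩
      m + m   ≡⟨ lemma m ⟩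
      2 * m   ≤⟨ *-monoˡ-≤ m (≤-trans (s≤s (s≤s z≤n)) (m≤n+m 9 (2 ^ suc k))) ⟩
      c * m   ∎
  go (r@(suc r′) , r^[k+1]ℓ≤m , m<) =
    -- Since `n < 2 ^ suc ℓ`, starting at `j = ℓ` with a full phase `b = 4 * r` covers all `n`
    -- vertices.
    suc (a + (ℓ * (4 * r) + 4 * r)) , color-budget r 1≤k a ℓ (4 * r) live ∣L∣≤ ∣⊤∣≤ , (begin
    suc (a + (ℓ * (4 * r) + 4 * r)) ^ suc k      ≤⟨ ^-monoˡ-≤ (suc k) T≤ ⟩
    (c * (r * ℓ)) ^ suc k                        ≡⟨ [m*n]^k≡m^k*n^k c (r * ℓ) (suc k) ⟩
    c ^ suc k * (r * ℓ) ^ suc k                  ≡⟨ cong (c ^ suc k *_) ([m*n]^k≡m^k*n^k r ℓ (suc k)) ⟩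
    c ^ suc k * (r ^ suc k * (ℓ * ℓ ^ k))        ≡⟨ lemma₁ (c ^ suc k) (r ^ suc k) ℓ (ℓ ^ k) ⟩
    c ^ suc k * (r ^ suc k * ℓ) * ℓ ^ k          ≤⟨ *-monoˡ-≤ (ℓ ^ k) (*-monoʳ-≤ (c ^ suc k) r^[k+1]ℓ≤m) ⟩
    c ^ suc k * m * ℓ ^ k                        ∎)
    where
    a : ℕ
    -- From `m < suc r ^ suc k * ℓ` and `suc r ≤ 2 * r` it follows that
    -- `m ≤ (2 * r) ^ suc k * ℓ = a * r ^ k`.
    a = 2 ^ suc k * r * ℓ
    lemma₁ : ∀ c x l y → c * (x * (l * y)) ≡ c * (x * l) * y
    lemma₁ = solve-∀
    lemma₂ : ∀ p r x l → p * (r * x) * l ≡ p * r * l * x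
    lemma₂ = solve-∀
    lemma₃ : ∀ x y → x * (2 * y) ≡ y * (x + x)
    lemma₃ = solve-∀
    lemma₄ : ∀ p x r l → 1 * x + (p * r * l + (l * (4 * r) + 4 * r * x)) ≡ p * r * l + (4 * (r * l) + (4 * (r * x) + x))
    lemma₄ = solve-∀
    lemma₅ : ∀ p r l → p * r * l + (4 * (r * l) + (4 * (r * l) + r * l)) ≡ (p + 9) * (r * l)
    lemma₅ = solve-∀
    1+r≤2r : suc r ≤ 2 * r
    1+r≤2r = s≤s (≤-trans (m≤m+n (suc r′) 0) (m≤n+m (r + 0) r′))
    ∣L∣≤ : length L ≤ a * r ^ k
    ∣L∣≤ = begin
      length L                      ≤⟨ ∣L∣≤m ⟩
      m                             ≤⟨ <⇒≤ m< ⟩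
      suc r ^ suc k * ℓ             ≤⟨ *-monoˡ-≤ ℓ (^-monoˡ-≤ (suc k) 1+r≤2r) ⟩
      (2 * r) ^ suc k * ℓ           ≡⟨ cong (_* ℓ) ([m*n]^k≡m^k*n^k 2 r (suc k)) ⟩
      2 ^ suc k * (r * r ^ k) * ℓ   ≡⟨ lemma₂ (2 ^ suc k) r (r ^ k) ℓ ⟩
      a * r ^ k                     ∎
    ∣⊤∣≤ : 4 * r * ∣ ⊤ {n} ∣ ≤ 2 ^ ℓ * (4 * r + 4 * r)
    ∣⊤∣≤ = begin
      4 * r * ∣ ⊤ {n} ∣        ≡⟨ cong (4 * r *_) (∣⊤∣≡n n) ⟩
      4 * r * n                ≤⟨ *-monoʳ-≤ (4 * r) (<⇒≤ (n<2^[1+⌊log₂n⌋] n)) ⟩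
      4 * r * (2 * 2 ^ ℓ)      ≡⟨ lemma₃ (4 * r) (2 ^ ℓ) ⟩
      2 ^ ℓ * (4 * r + 4 * r)  ∎
    1≤rℓ : 1 ≤ r * ℓ
    1≤rℓ = *-mono-≤ (s≤s (z≤n {r′})) 1≤ℓ
    T≤ : suc (a + (ℓ * (4 * r) + 4 * r)) ≤ c * (r * ℓ)
    T≤ = begin
      1 + (a + (ℓ * (4 * r) + 4 * r))                          ≡⟨ cong (λ z → 1 + (a + (ℓ * (4 * r) + z))) (*-identityʳ (4 * r)) ⟨
      1 + (a + (ℓ * (4 * r) + 4 * r * 1))                      ≡⟨ lemma₄ (2 ^ suc k) 1 r ℓ ⟩
      a + (4 * (r * ℓ) + (4 * (r * 1) + 1))                    ≤⟨ +-monoʳ-≤ a (+-monoʳ-≤ (4 * (r * ℓ)) (+-mono-≤ (*-monoʳ-≤ 4 (*-monoʳ-≤ r 1≤ℓ)) 1≤rℓ)) ⟩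
      a + (4 * (r * ℓ) + (4 * (r * ℓ) + r * ℓ))                ≡⟨ lemma₅ (2 ^ suc k) r ℓ ⟩
      c * (r * ℓ)                                              ∎

theorem5 : (k : ℕ) → 1 < k →
    ∃ λ (C : ℕ) → (n m e : ℕ) → 2 ≤ n → 1 ≤ m → e ≤ m →
    (H : Hypergraph n e) →
    ∃ λ (t : ℕ) → KCFColorableWith k H t ×
    t ^ suc k ≤ C * m * ⌊log₂ n ⌋ ^ k
theorem5 k 1<k = (2 ^ suc k + 9) ^ suc k , coloring
  where
  coloring : (n m e : ℕ) → 2 ≤ n → 1 ≤ m → e ≤ m → (H : Hypergraph n e) →
    ∃ λ (t : ℕ) → KCFColorableWith k H t × t ^ suc k ≤ (2 ^ suc k + 9) ^ suc k * m * ⌊log₂ n ⌋ ^ k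
  coloring n m e 2≤n 1≤m e≤m H = finish (edge-list-bound (<⇒≤ 1<k) n m 2≤n 1≤m live ∣L∣≤m)
    where
    big? = λ (S : Subset n) → k <? ∣ S ∣
    L : List (Subset n)
    -- Edges with at most `k` vertices are set aside: any colouring serves those that are nonempty.
    L = filter big? (tabulate H)
    live : Live k ⊤ L
    live = record { within = λ _ _ → ∈⊤ ; large = λ S∈L → proj₂ (∈-filter⁻ big? {xs = tabulate H} S∈L) }
    ∣L∣≤m : length L ≤ m
    ∣L∣≤m = ≤-trans (length-filter big? (tabulate H)) (≤-trans (≤-reflexive (length-tabulate H)) e≤m)
    finish : (∃ λ T → Colorable k L T × T ^ suc k ≤ (2 ^ suc k + 9) ^ suc k * m * ⌊log₂ n ⌋ ^ k) →
      ∃ λ (t : ℕ) → KCFColorableWith k H t × t ^ suc k ≤ (2 ^ suc k + 9) ^ suc k * m * ⌊log₂ n ⌋ ^ k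
    finish (T , (t , t≤T , c , handled) , T≤) = t , (c , isCF) , ≤-trans (^-monoˡ-≤ (suc k) t≤T) T≤
      where
      isCF : IsKCFColoring k H c
      isCF j nonempty with k <? ∣ H j ∣
      ... | yes k< = handled (∈-filter⁺ big? (∈-tabulate⁺ j) k<)
      ... | no k≮ = small⇒Handled c nonempty (≮⇒≥ k≮)
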